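{- $S(1,2) = \mathbb{N}_0 \setminus \{1\}$.
   Context: Let $t \le k$ and $v$ be positive integers, $V = \{1,\dots,v\}$, and let $V^k$ be the set of ordered $k$-tuples of elements of $V$. For a $t$-subset $I = \{i_1 < \cdots < i_t\}$ of $\{1,\dots,k\}$ and $(u_1,\dots,u_t) \in V^t$, the tuple $(x_1,\dots,x_k) \in V^k$ is said to contain $(u_1,\dots,u_t)_I$ if $x_{i_j} = u_j$ for all $j = 1,\dots,t$. A $t$-$(v,k)$ Latin trade of volume $s$ is a pair $T = (T_1,T_2)$ of disjoint collections (finite multisets, i.e. repeated elements are allowed; disjoint means no tuple occurs in both), each consisting of $s$ elements of $V^k$ counted with multiplicity, such that for each $t$-subset $I \subseteq \{1,\dots,k\}$ and each $(u_1,\dots,u_t) \in V^t$, the number of elements (with multiplicity) of $T_1$ containing $(u_1,\dots,u_t)_I$ equals the number of elements of $T_2$ containing $(u_1,\dots,u_t)_I$. The trade with $T_1 = T_2 = \emptyset$ (volume $0$) is allowed. The spectrum $S(t,k)$ is the set of all integers $s$ for which there exists, for some $v$, a $t$-$(v,k)$ Latin trade of volume $s$. $\mathbb{N}_0$ denotes the nonnegative integers. -}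

module Defs where

open import Data.Fin.Base using (Fin; _<_)
import Data.Fin.Properties as Fin
open import Data.List.Base using (List; length; filter)
open import Data.List.Relation.Binary.Disjoint.Propositional using (Disjoint)
open import Data.Nat.Base using (ℕ; NonZero)
open import Data.Product.Base using (_×_; ∃-syntax)
open import Data.Vec.Base using (Vec; lookup)
open import Level using (0ℓ)
open import Relation.Binary.Core using (_Preserves_⟶_)
open import Relation.Binary.PropositionalEquality.Core using (_≡_)
open import Relation.Unary using (Pred; Decidable)

private
  variable
    t v k : ℕ

-- The set V = {1, …, v} is represented by Fin v, and V^k by Vec (Fin v) k.
-- A t-subset I = {i₁ < ⋯ < i_t} of the k positions is represented by its
-- increasing enumeration, a strictly monotone map Fin t → Fin k.

Contains : (Fin t → Fin k) → Vec (Fin v) t → Pred (Vec (Fin v) k) 0ℓ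
Contains I u x = ∀ j → lookup x (I j) ≡ lookup u j

contains? : (I : Fin t → Fin k) (u : Vec (Fin v) t) → Decidable (Contains I u)
contains? I u x = Fin.all? λ j → lookup x (I j) Fin.≟ lookup u j

-- Finite multisets are represented by lists; nothing below depends on the
-- order of the entries, and repeated entries count with multiplicity.

#containing : (Fin t → Fin k) → Vec (Fin v) t → List (Vec (Fin v) k) → ℕ
#containing I u T = length (filter (contains? I u) T)

record LatinTrade (t v k s : ℕ) : Set where
  field
    T₁ T₂    : List (Vec (Fin v) k)
    volume₁  : length T₁ ≡ s
    volume₂  : length T₂ ≡ s
    disjoint : Disjoint T₁ T₂
    balanced : (I : Fin t → Fin k) → I Preserves _<_ ⟶ _<_ →
               (u : Vec (Fin v) t) → #containing I u T₁ ≡ #containing I u T₂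

-- Intended for 1 ≤ t ≤ k.  A volume is the size of a finite multiset, so the
-- spectrum is a set of natural numbers.

Spectrum : (t k : ℕ) → Pred ℕ 0ℓ
Spectrum t k s = ∃[ v ] NonZero v × LatinTrade t v k s

{-# OPTIONS --safe #-}
-- A volume-1 pair agrees in every coordinate, so it is not disjoint.  All other
-- volumes are sums of 2s and 3s; these are realised over three symbols by
-- replacing diagonal tuples (i , i) by (i , π i) for a 2-cycle or 3-cycle π.
-- As T₁ always stays on the diagonal and T₂ off it, sums remain disjoint.
module Submission where

open import Defs
open import Relation.Unary using (_≐_; U; _∖_; ｛_｝)
open import Data.Empty using (⊥-elim)
open import Data.Fin.Base using (Fin; zero; suc; _<_)
open import Data.Fin.Patterns using (0F; 1F; 2F)
import Data.Fin.Properties as Fin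
open import Data.List.Base using (List; []; _∷_; [_]; _++_; length; filter)
open import Data.List.Properties using (filter-++; filter-accept; filter-reject; filter-≐; length-++)
open import Data.List.Relation.Unary.All as All using (All; []; _∷_)
open import Data.List.Relation.Unary.All.Properties using (++⁺)
open import Data.List.Relation.Unary.Any using (here)
open import Data.Nat.Base using (ℕ; suc; _+_)
open import Data.Nat.Properties using (_≟_)
open import Data.Product.Base using (_,_)
open import Data.Unit.Base using (tt)
open import Data.Vec.Base using (Vec; []; _∷_; head; last; lookup)
open import Data.Vec.Relation.Binary.Pointwise.Extensional using (ext; Pointwise-≡⇒≡)
open import Relation.Binary.Core using (_Preserves_⟶_)
open import Relation.Binary.PropositionalEquality
  using (_≡_; _≢_; refl; sym; trans; cong; cong₂; module ≡-Reasoning)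
open import Relation.Nullary using (Dec; ¬_; yes; no)
open import Relation.Nullary.Decidable using (from-yes)

private
  variable
    t v k s s′ : ℕ

Balanced : (t : ℕ) → List (Vec (Fin v) k) → List (Vec (Fin v) k) → Set
Balanced {v} {k} t T₁ T₂ =
  (I : Fin t → Fin k) → I Preserves _<_ ⟶ _<_ →
  (u : Vec (Fin v) t) → #containing I u T₁ ≡ #containing I u T₂

#containing-++ : (I : Fin t → Fin k) (u : Vec (Fin v) t) (T T′ : List (Vec (Fin v) k)) →
                 #containing I u (T ++ T′) ≡ #containing I u T + #containing I u T′
#containing-++ I u T T′ =
  trans (cong length (filter-++ (contains? I u) T T′)) (length-++ (filter (contains? I u) T))

-- Pointwise equal position maps need not be propositionally equal, but they make the two `Contains`
-- predicates equivalent, so both filters keep the same tuples.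
#containing-cong : {I J : Fin t → Fin k} → (∀ j → I j ≡ J j) → (u : Vec (Fin v) t) →
                   (T : List (Vec (Fin v) k)) → #containing I u T ≡ #containing J u T
#containing-cong {I = I} {J} I≗J u T =
  cong length (filter-≐ (contains? I u) (contains? J u) ((λ {x} → I⇒J x) , λ {x} → J⇒I x) T)
  where
  I⇒J : ∀ x → Contains I u x → Contains J u x
  I⇒J x x∋u j = trans (cong (lookup x) (sym (I≗J j))) (x∋u j)

  J⇒I : ∀ x → Contains J u x → Contains I u x
  J⇒I x x∋u j = trans (cong (lookup x) (I≗J j)) (x∋u j)

-- Balance for `t = 1` with the position map replaced by a single column: both quantifiers now range
-- over finite types, so the property can be decided by evaluation.
ColumnBalanced : List (Vec (Fin v) k) → List (Vec (Fin v) k) → Set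
ColumnBalanced T₁ T₂ =
  ∀ i a → #containing (λ _ → i) (a ∷ []) T₁ ≡ #containing (λ _ → i) (a ∷ []) T₂

columnBalanced? : (T₁ T₂ : List (Vec (Fin v) k)) → Dec (ColumnBalanced T₁ T₂)
columnBalanced? T₁ T₂ = Fin.all? λ i → Fin.all? λ a →
  #containing (λ _ → i) (a ∷ []) T₁ ≟ #containing (λ _ → i) (a ∷ []) T₂

columnBalanced⇒balanced : (T₁ T₂ : List (Vec (Fin v) k)) →
                          ColumnBalanced T₁ T₂ → Balanced 1 T₁ T₂
columnBalanced⇒balanced T₁ T₂ balanced I _ u@(a ∷ []) = begin
  #containing I u T₁               ≡⟨ #containing-cong I≗const u T₁ ⟩
  #containing (λ _ → I zero) u T₁  ≡⟨ balanced (I zero) a ⟩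
  #containing (λ _ → I zero) u T₂  ≡⟨ #containing-cong I≗const u T₂ ⟨
  #containing I u T₂               ∎
  where
  open ≡-Reasoning

  I≗const : ∀ j → I j ≡ I zero
  I≗const zero = refl

#containing-[_]≡1⇒Contains : (x : Vec (Fin v) k) (I : Fin t → Fin k) (u : Vec (Fin v) t) →
                             #containing I u [ x ] ≡ 1 → Contains I u x
#containing-[ x ]≡1⇒Contains I u eq with contains? I u x
... | yes x∋u = x∋u
... | no  x∌u with () ← trans (sym eq) (cong length (filter-reject (contains? I u) {xs = []} x∌u))

-- Test column `i` against the entry that `x` has there: `x` is counted once, so `y` must be counted
-- too and shares that entry.
balanced-[]-[]⇒≡ : {x y : Vec (Fin v) k} → Balanced 1 [ x ] [ y ] → y ≡ x
balanced-[]-[]⇒≡ {x = x} {y} balanced = Pointwise-≡⇒≡ (ext agree)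
  where
  agree : ∀ i → lookup y i ≡ lookup x i
  agree i = #containing-[ y ]≡1⇒Contains I u #≡1 zero
    where
    I : Fin 1 → Fin _
    I _ = i

    u : Vec (Fin _) 1
    u = lookup x i ∷ []

    I-mono : I Preserves _<_ ⟶ _<_
    I-mono {zero} {zero} ()

    #≡1 : #containing I u [ y ] ≡ 1
    #≡1 = trans (sym (balanced I I-mono u))
                (cong length (filter-accept (contains? I u) {x} {[]} λ { zero → refl }))

¬LatinTrade-1-volume-1 : ¬ LatinTrade 1 v k 1
-- The volume equations rule out every other shape of the two lists.
¬LatinTrade-1-volume-1 record
  { T₁ = x ∷ [] ; T₂ = y ∷ [] ; disjoint = disjoint ; balanced = balanced } =
  disjoint (here (balanced-[]-[]⇒≡ balanced) , here refl)

Diagonal : Vec (Fin v) 2 → Set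
Diagonal x = head x ≡ last x

-- Disjointness alone is not inherited by sums, since `T₁` of one summand may meet `T₂` of the
-- other. Conditions on each tuple separately are inherited.
record DiagonalTrade (v s : ℕ) : Set where
  field
    T₁ T₂       : List (Vec (Fin v) 2)
    volume₁     : length T₁ ≡ s
    volume₂     : length T₂ ≡ s
    diagonal    : All Diagonal T₁
    offDiagonal : All (λ x → ¬ Diagonal x) T₂
    balanced    : Balanced 1 T₁ T₂

toLatinTrade : DiagonalTrade v s → LatinTrade 1 v 2 s
toLatinTrade T = record
  { T₁       = T₁
  ; T₂       = T₂
  ; volume₁  = volume₁
  ; volume₂  = volume₂
  ; disjoint = λ (x∈T₁ , x∈T₂) → All.lookup offDiagonal x∈T₂ (All.lookup diagonal x∈T₁)
  ; balanced = balanced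
  }
  where open DiagonalTrade T

_⊕_ : DiagonalTrade v s → DiagonalTrade v s′ → DiagonalTrade v (s + s′)
S ⊕ T = record
  { T₁          = S.T₁ ++ T.T₁
  ; T₂          = S.T₂ ++ T.T₂
  ; volume₁     = trans (length-++ S.T₁) (cong₂ _+_ S.volume₁ T.volume₁)
  ; volume₂     = trans (length-++ S.T₂) (cong₂ _+_ S.volume₂ T.volume₂)
  ; diagonal    = ++⁺ S.diagonal T.diagonal
  ; offDiagonal = ++⁺ S.offDiagonal T.offDiagonal
  ; balanced    = λ I mono u → begin
      #containing I u (S.T₁ ++ T.T₁)                 ≡⟨ #containing-++ I u S.T₁ T.T₁ ⟩
      #containing I u S.T₁ + #containing I u T.T₁    ≡⟨ cong₂ _+_ (S.balanced I mono u) (T.balanced I mono u) ⟩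
      #containing I u S.T₂ + #containing I u T.T₂    ≡⟨ #containing-++ I u S.T₂ T.T₂ ⟨
      #containing I u (S.T₂ ++ T.T₂)                 ∎
  }
  where
  module S = DiagonalTrade S
  module T = DiagonalTrade T
  open ≡-Reasoning

empty : DiagonalTrade v 0
empty = record
  { T₁ = [] ; T₂ = [] ; volume₁ = refl ; volume₂ = refl
  ; diagonal = [] ; offDiagonal = [] ; balanced = λ _ _ _ → refl }

-- Two symbols would carry this trade; it lives over three so that it can be added to `3-cycle`.
2-cycle : DiagonalTrade 3 2
2-cycle = record
  { T₁          = T₁
  ; T₂          = T₂
  ; volume₁     = refl
  ; volume₂     = refl
  ; diagonal    = refl ∷ refl ∷ []
  ; offDiagonal = (λ ()) ∷ (λ ()) ∷ []
  -- Evaluation compares the counts for all two columns and three symbols.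
  ; balanced    = columnBalanced⇒balanced T₁ T₂ (from-yes (columnBalanced? T₁ T₂))
  }
  where
  T₁ T₂ : List (Vec (Fin 3) 2)
  T₁ = (0F ∷ 0F ∷ []) ∷ (1F ∷ 1F ∷ []) ∷ []
  T₂ = (0F ∷ 1F ∷ []) ∷ (1F ∷ 0F ∷ []) ∷ []

3-cycle : DiagonalTrade 3 3
3-cycle = record
  { T₁          = T₁
  ; T₂          = T₂
  ; volume₁     = refl
  ; volume₂     = refl
  ; diagonal    = refl ∷ refl ∷ refl ∷ []
  ; offDiagonal = (λ ()) ∷ (λ ()) ∷ (λ ()) ∷ []
  ; balanced    = columnBalanced⇒balanced T₁ T₂ (from-yes (columnBalanced? T₁ T₂))
  }
  where
  T₁ T₂ : List (Vec (Fin 3) 2)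
  T₁ = (0F ∷ 0F ∷ []) ∷ (1F ∷ 1F ∷ []) ∷ (2F ∷ 2F ∷ []) ∷ []
  T₂ = (0F ∷ 1F ∷ []) ∷ (1F ∷ 2F ∷ []) ∷ (2F ∷ 0F ∷ []) ∷ []

diagonalTrade : ∀ s → 1 ≢ s → DiagonalTrade 3 s
diagonalTrade 0 _ = empty
diagonalTrade 1 1≢1 = ⊥-elim (1≢1 refl)
diagonalTrade 2 _ = 2-cycle
diagonalTrade 3 _ = 3-cycle
-- From volume 4 on, removing 2 leaves `s` at least 2, so the recursion never reaches the excluded
-- volume 1 and ends at 2 or 3 according to parity.
diagonalTrade (suc (suc s@(suc (suc _)))) _ = 2-cycle ⊕ diagonalTrade s λ ()

proposition1 : Spectrum 1 2 ≐ U ∖ ｛ 1 ｝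
proposition1 =
    (λ { (_ , _ , T) → tt , λ { refl → ¬LatinTrade-1-volume-1 T } })
  -- The same three symbols serve every volume, because tuples may be repeated.
  , (λ {s} (_ , 1≢s) → 3 , _ , toLatinTrade (diagonalTrade s 1≢s))
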